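{- Let $\ell\ge 2$. Let $\mu$ be an $\ell$-core with $\mu_1-\mu_2\neq \ell-1$, let $r\ge 0$ be an integer, and let $\kappa=(\kappa_1,\dots,\kappa_{r+1})$ be a partition with at most $r+1$ parts. Then the partition $\lambda\approx(\mu,r,\kappa)$ is an $\ell$-partition. Conversely, every $\ell$-partition corresponds uniquely to such a triple $(\mu,r,\kappa)$, i.e. for every $\ell$-partition $\lambda$ there is exactly one such triple with $\lambda\approx(\mu,r,\kappa)$.
   Context: A partition is $\ell$-regular if it does not have $\ell$ or more equal nonzero parts. A removable $\ell$-rim hook (for short, $\ell$-rim hook) of $\lambda$ is a connected sequence of $\ell$ boxes of the Young diagram of $\lambda$, containing no $2\times2$ square, whose removal from $\lambda$ leaves the Young diagram of a partition. It is horizontal if all its boxes lie in one row, and non-horizontal otherwise. An $\ell$-core is a partition with no removable $\ell$-rim hook. An $\ell$-partition is an $\ell$-regular partition which has no non-horizontal $\ell$-rim hooks and such that, after removing any number of horizontal $\ell$-rim hooks in any order, the remaining diagram has no non-horizontal $\ell$-rim hooks. Partitions are extended by parts equal to $0$ when needed. For $\mu=(\mu_1,\dots,\mu_s)$, $r$, $\kappa$ as in the claim, let $\nu$ be the partition with $\nu_{j}=\mu_1+(r-j+1)(\ell-1)$ for $1\le j\le r$ and $\nu_{r+i}=\mu_i$ for $i\ge 1$. The notation $\lambda\approx(\mu,r,\kappa)$ means that $\lambda_i=\nu_i+\ell\kappa_i$ for $1\le i\le r+1$ and $\lambda_i=\nu_i$ for $i>r+1$. -}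

module Defs where

open import Data.Bool.Base using (if_then_else_)
open import Data.List.Base using (List; []; _∷_; length; filter)
open import Data.List.Relation.Unary.All using (All)
open import Data.List.Relation.Unary.Linked using (Linked)
open import Data.Nat.Base
  using (ℕ; zero; suc; _+_; _*_; _∸_; ∣_-_∣; _≤_; _<_; _≥_; _<ᵇ_)
open import Data.Nat.Properties using (_≟_)
open import Data.Product.Base using (Σ-syntax; ∃-syntax; _×_; _,_; proj₁)
open import Data.Sum.Base using (_⊎_)
open import Data.Vec.Base using (Vec)
open import Data.Vec.Membership.Propositional using (_∈_; _∉_)
import Data.Vec.Relation.Unary.All as VecAll
import Data.Vec.Relation.Unary.Linked as VecLinked
open import Data.Vec.Relation.Unary.Unique.Propositional using (Unique)
open import Function.Bundles using (_⇔_)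
open import Relation.Binary.Construct.Closure.ReflexiveTransitive using (Star)
open import Relation.Binary.PropositionalEquality.Core using (_≡_; _≢_)
open import Relation.Nullary.Negation.Core using (¬_)

-- Only nonzero parts are stored, so each partition has exactly one list of
-- parts; `part` supplies the extension by zeros.
record Partition : Set where
  constructor mkPartition
  field
    parts      : List ℕ
    decreasing : Linked _≥_ parts
    positive   : All (0 <_) parts

open Partition public

nth : List ℕ → ℕ → ℕ
nth []       _       = 0
nth (x ∷ _)  zero    = x
nth (_ ∷ xs) (suc i) = nth xs i

-- Indexing starts at 0: `part p i` is the (i+1)-st part of p.
part : Partition → ℕ → ℕ
part p = nth (parts p)

multiplicity : ℕ → Partition → ℕ
multiplicity k p = length (filter (_≟ k) (parts p))

Regular : ℕ → Partition → Set
Regular ℓ p = ¬ (∃[ k ] 0 < k × ℓ ≤ multiplicity k p)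

infix 4 _∈Diagram_ _≈[_]_

-- (row , column), both counted from 0.
Box : Set
Box = ℕ × ℕ

_∈Diagram_ : Box → Partition → Set
(i , j) ∈Diagram p = j < part p i

Adjacent : Box → Box → Set
Adjacent (i , j) (i′ , j′) =
  (i ≡ i′ × ∣ j - j′ ∣ ≡ 1) ⊎ (∣ i - i′ ∣ ≡ 1 × j ≡ j′)

record RimHook (ℓ : ℕ) (p : Partition) : Set where
  field
    boxes     : Vec Box ℓ
    distinct  : Unique boxes
    inside    : VecAll.All (_∈Diagram p) boxes
    connected : VecLinked.Linked Adjacent boxes
    no2×2     : ∀ i j → ¬ ( (i , j) ∈ boxes × (i , suc j) ∈ boxes
                          × (suc i , j) ∈ boxes × (suc i , suc j) ∈ boxes )
    remainder : Partition
    removal   : ∀ b → b ∈Diagram remainder ⇔ (b ∈Diagram p × b ∉ boxes)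

open RimHook public

Horizontal : ∀ {ℓ p} → RimHook ℓ p → Set
Horizontal h = ∃[ i ] VecAll.All (λ b → proj₁ b ≡ i) (boxes h)

IsCore : ℕ → Partition → Set
IsCore ℓ p = ¬ RimHook ℓ p

NoNonHorizontal : ℕ → Partition → Set
NoNonHorizontal ℓ p = ¬ (Σ[ h ∈ RimHook ℓ p ] ¬ Horizontal h)

HorizontalRemoval : ℕ → Partition → Partition → Set
HorizontalRemoval ℓ p q =
  Σ[ h ∈ RimHook ℓ p ] Horizontal h × remainder h ≡ q

record IsℓPartition (ℓ : ℕ) (p : Partition) : Set where
  field
    regular         : Regular ℓ p
    noNonHorizontal : NoNonHorizontal ℓ p
    hereditary      : ∀ q → Star (HorizontalRemoval ℓ) p q → NoNonHorizontal ℓ q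

Triple : Set
Triple = Partition × ℕ × Partition

-- Truncated subtraction loses nothing here once ℓ ≥ 1, as parts are decreasing.
Admissible : ℕ → Triple → Set
Admissible ℓ (μ , r , κ) =
  IsCore ℓ μ × part μ 0 ∸ part μ 1 ≢ ℓ ∸ 1 × length (parts κ) ≤ suc r

-- ν ℓ μ r j is ν_{j+1}, so the factor r - (j+1) + 1 becomes r ∸ j.
ν : ℕ → Partition → ℕ → ℕ → ℕ
ν ℓ μ r j = if j <ᵇ r then part μ 0 + (r ∸ j) * (ℓ ∸ 1) else part μ (j ∸ r)

-- p ≈[ ℓ ] (μ , r , κ); rows 1, …, r+1 are the indices i ≤ r.
_≈[_]_ : Partition → ℕ → Triple → Set
p ≈[ ℓ ] (μ , r , κ) =
    (∀ i → i ≤ r → part p i ≡ ν ℓ μ r i + ℓ * part κ i)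
  × (∀ i → r < i → part p i ≡ ν ℓ μ r i)

{-# OPTIONS --safe #-}
module Submission where

-- Everything reduces to inequalities between rows.  A rim hook on rows i, …, d + i
-- exists iff λ_{d+i+1} + ℓ ≤ λᵢ + d < λ_{d+i} + ℓ, and it is horizontal iff d = 0.
-- The partitions λ ≈ (μ, r, κ) are those with λᵢ - λᵢ₊₁ ≡ -1 (mod ℓ) for i < r,
-- λᵣ ≡ μ₀ (mod ℓ) with λᵣ ≥ μ₀, and λᵣ₊ᵢ = μᵢ for i ≥ 1 (rows counted from 0).  As μ
-- is a core, horizontal removals preserve this shape, and it excludes non-horizontal hooks.
-- Conversely, r must be the least i with λᵢ - λᵢ₊₁ ≢ -1 (mod ℓ), which determines
-- μ and κ; after all horizontal hooks are taken off row r, a hook of μ would give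
-- a non-horizontal hook of λ, possibly after further horizontal removals.

open import Defs
open import Data.Fin.Properties using (injective⇒≤)
open import Data.List.Base using (List; []; _∷_; length; filter)
open import Data.List.Properties using (filter-accept; filter-reject)
open import Data.List.Relation.Unary.All as All using (All; []; _∷_)
open import Data.List.Relation.Unary.Linked as Linked using (Linked; []; [-]; _∷_)
open import Data.Nat.Base
open import Data.Nat.Divisibility using (_∣_; _∣?_; divides; ∣⇒≤; ∣1⇒≡1; ∣m+n∣m⇒∣n; n∣m*n)
open import Data.Nat.DivMod using (_%_; _/_; m≡m%n+[m/n]*n; m%n<n; m<n⇒m%n≡m; [m+kn]%n≡m%n)
open import Data.Nat.Properties
open import Data.Nat.Tactic.RingSolver using (solve-∀)
open import Data.Product using (∃; ∃!; Σ-syntax; ∃-syntax; _×_; _,_; proj₁; proj₂)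
open import Data.Product.Properties using (≡-dec)
open import Data.Sum.Base using (_⊎_; inj₁; inj₂)
open import Data.Vec.Base as Vec using (Vec; []; _∷_)
open import Data.Vec.Membership.DecPropositional (≡-dec _≟_ _≟_) using (_∈?_)
open import Data.Vec.Membership.Propositional using (_∈_; _∉_)
open import Data.Vec.Membership.Propositional.Properties using (∈-lookup)
open import Data.Vec.Relation.Unary.Any using (here; there)
open import Data.Vec.Relation.Unary.Any.Properties using (lookup-index)
import Data.Vec.Relation.Unary.All as VecAll
import Data.Vec.Relation.Unary.All.Properties as VecAll
import Data.Vec.Relation.Unary.Linked as VecLinked
open import Data.Vec.Relation.Unary.Unique.Propositional using (Unique; []; _∷_)
open import Data.Vec.Relation.Unary.Unique.Propositional.Properties using (lookup-injective)
open import Function.Base using (_∘_; case_of_)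
open import Function.Bundles using (_⇔_; mk⇔; Equivalence)
open import Relation.Binary.Construct.Closure.ReflexiveTransitive using (Star; ε; _◅_)
open import Relation.Binary.Definitions using (tri<; tri≈; tri>)
open import Relation.Binary.PropositionalEquality
open import Relation.Nullary using (¬_; Dec; yes; no; contradiction)
open import Relation.Nullary.Decidable using (decidable-stable; ¬?)

open Equivalence using (to; from)

-- Partitions and their rows.

antitone : (f : ℕ → ℕ) → (∀ i → f (suc i) ≤ f i) → ∀ {i j} → i ≤ j → f j ≤ f i
antitone f step {j = zero}  z≤n = ≤-refl
antitone f step {j = suc j} i≤1+j with m≤n⇒m<n∨m≡n i≤1+j
... | inj₁ i<1+j = ≤-trans (step j) (antitone f step (≤-pred i<1+j))
... | inj₂ refl  = ≤-refl

nth-step : ∀ {xs} → Linked _≥_ xs → ∀ i → nth xs (suc i) ≤ nth xs i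
nth-step []          i       = z≤n
nth-step [-]         i       = z≤n
nth-step (x≥y ∷ _)   zero    = x≥y
nth-step (_ ∷ xs↘)   (suc i) = nth-step xs↘ i

part-step : ∀ p i → part p (suc i) ≤ part p i
part-step p = nth-step (decreasing p)

part-antitone : ∀ p {i j} → i ≤ j → part p j ≤ part p i
part-antitone p = antitone (part p) (part-step p)

nth-length : ∀ xs {i} → length xs ≤ i → nth xs i ≡ 0
nth-length []       _         = refl
nth-length (x ∷ xs) (s≤s len) = nth-length xs len

cons : ∀ x → 0 < x → (q : Partition) → part q 0 ≤ x → Partition
cons x 0<x q q₀≤x = mkPartition (x ∷ parts q) (linked (parts q) (decreasing q) q₀≤x) (0<x ∷ positive q)
  where
  linked : ∀ ys → Linked _≥_ ys → nth ys 0 ≤ x → Linked _≥_ (x ∷ ys)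
  linked []       _   _   = [-]
  linked (y ∷ ys) ys↘ y≤x = y≤x ∷ ys↘

-- The stored list has to stop at the first zero row; since `f` is antitone, nothing nonzero
-- follows. The length bound is what later gives `κ` at most r + 1 parts.
fromRows : (f : ℕ → ℕ) → (∀ i → f (suc i) ≤ f i) → ∀ n → f n ≡ 0 →
           Σ[ q ∈ Partition ] (∀ i → part q i ≡ f i) × length (parts q) ≤ n
fromRows f step zero f₀≡0 =
  mkPartition [] [] [] , (λ i → sym (n≤0⇒n≡0 (subst (f i ≤_) f₀≡0 (antitone f step z≤n)))) , z≤n
fromRows f step (suc n) fₙ≡0 with f 0 in f₀≡
... | zero = mkPartition [] [] []
           , (λ i → sym (n≤0⇒n≡0 (subst (f i ≤_) f₀≡ (antitone f step z≤n)))) , z≤n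
... | suc x with fromRows (f ∘ suc) (step ∘ suc) n fₙ≡0
...   | q , q≗ , len = cons (suc x) z<s q q₀≤ , rows , s≤s len
  where
  q₀≤ = subst₂ _≤_ (sym (q≗ 0)) f₀≡ (step 0)
  rows : ∀ i → part (cons (suc x) z<s q q₀≤) i ≡ f i
  rows zero    = sym f₀≡
  rows (suc i) = q≗ i

nth-injective : ∀ {xs ys} → All (0 <_) xs → All (0 <_) ys → nth xs ≗ nth ys → xs ≡ ys
nth-injective []         []         _  = refl
nth-injective []         (0<y ∷ _)  eq = contradiction (eq 0) (<⇒≢ 0<y)
nth-injective (0<x ∷ _)  []         eq = contradiction (sym (eq 0)) (<⇒≢ 0<x)
nth-injective (_ ∷ 0<xs) (_ ∷ 0<ys) eq = cong₂ _∷_ (eq 0) (nth-injective 0<xs 0<ys (eq ∘ suc))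

part-injective : ∀ {p q} → part p ≗ part q → p ≡ q
part-injective {mkPartition xs xs↘ 0<xs} {mkPartition ys ys↘ 0<ys} eq
  with refl ← nth-injective 0<xs 0<ys eq
  = cong₂ (mkPartition xs) (Linked.irrelevant ≤-irrelevant xs↘ ys↘) (All.irrelevant ≤-irrelevant 0<xs 0<ys)

-- Ribbons and the rim hooks on them.

-- Applied in both directions, it shows that two duplicate-free listings of the same boxes have
-- equal length, which identifies the size of a ribbon.
unique-⊆⇒≤ : ∀ {A : Set} {m n} {xs : Vec A m} {ys : Vec A n} →
             Unique xs → (∀ {x} → x ∈ xs → x ∈ ys) → m ≤ n
unique-⊆⇒≤ {m = m} {n} {xs} {ys} xs! xs⊆ys =
  injective⇒≤ λ {i} {j} eq → lookup-injective xs! i j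
    (trans (lookup-index (position i)) (trans (cong (Vec.lookup ys) eq) (sym (lookup-index (position j)))))
  where
  position : ∀ i → Vec.lookup xs i ∈ ys
  position i = xs⊆ys (∈-lookup i xs)

-- The rim hook p / q occupies exactly the rows i, …, d + i.
record Ribbon (ℓ : ℕ) (p q : Partition) (i d : ℕ) : Set where
  field
    above : ∀ j → j < i → part q j ≡ part p j
    below : ∀ j → d + i < j → part q j ≡ part p j
    inner : ∀ j → i ≤ j → j < d + i → suc (part q j) ≡ part p (suc j)
    last  : part q (d + i) < part p (d + i)
    size  : part p i + d ≡ part q (d + i) + ℓ

  nonempty : ∀ {j} → i ≤ j → j ≤ d + i → part q j < part p j
  nonempty {j} i≤j j≤k with m≤n⇒m<n∨m≡n j≤k
  ... | inj₁ j<k  = subst (_≤ part p j) (sym (inner j i≤j j<k)) (part-step p j)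
  ... | inj₂ refl = last

  ⊆ : ∀ j → part q j ≤ part p j
  ⊆ j with j <? i
  ... | yes j<i = ≤-reflexive (above j j<i)
  ... | no  j≮i with d + i <? j
  ...   | yes k<j = ≤-reflexive (below j k<j)
  ...   | no  k≮j = <⇒≤ (nonempty (≮⇒≥ j≮i) (≮⇒≥ k≮j))

  row-bounds : ∀ {j c} → part q j ≤ c → c < part p j → i ≤ j × j ≤ d + i
  row-bounds {j} q≤c c<p with j <? i | d + i <? j
  ... | yes j<i | _       = contradiction (≤-<-trans q≤c c<p) (<-irrefl (above j j<i))
  ... | no _    | yes k<j = contradiction (≤-<-trans q≤c c<p) (<-irrefl (below j k<j))
  ... | no j≮i  | no k≮j  = ≮⇒≥ j≮i , ≮⇒≥ k≮j

InSkew : Partition → Partition → Box → Set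
InSkew p q (r , c) = part q r ≤ c × c < part p r

module Walk {ℓ p q i d} (R : Ribbon ℓ p q i d) where
  open Ribbon R

  -- The boxes of p / q on the walk from (r , c) up and to the right.
  Ahead : ℕ → ℕ → Box → Set
  Ahead r c (x , y) = InSkew p q (x , y) × x ≤ r × (x ≡ r → c ≤ y)

  record Path (n r c : ℕ) : Set where
    field
      steps  : Vec Box (suc n)
      start  : Vec.head steps ≡ (r , c)
      linked : VecLinked.Linked Adjacent steps
      unique : Unique steps
      member : ∀ b → b ∈ steps ⇔ Ahead r c b

  open Path

  extend : ∀ {n r c r′ c′} (P : Path n r′ c′) → Adjacent (r , c) (r′ , c′) →
           (∀ {b} → Ahead r′ c′ b → b ≢ (r , c)) →
           (∀ {b} → Ahead r c b ⇔ (b ≡ (r , c) ⊎ Ahead r′ c′ b)) →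
           Path (suc n) r c
  extend {r = r} {c} P adj notAhead split = record
    { steps  = (r , c) ∷ steps P
    ; start  = refl
    ; linked = subst (Adjacent (r , c)) (sym (start P)) adj VecLinked.∷ linked P
    ; unique = VecAll.lookup⁻ (λ j eq →
                 notAhead (to (member P _) (∈-lookup j (steps P))) (sym eq)) ∷ unique P
    ; member = λ b → mk⇔
        (λ { (here eq) → from split (inj₁ eq) ; (there b∈) → from split (inj₂ (to (member P b) b∈)) })
        (λ ahead → case to split ahead of λ
          { (inj₁ eq) → here eq ; (inj₂ ahead′) → there (from (member P b) ahead′) })
    }

  -- A step up or to the right raises column minus row by one. The walk ends at the last box of row
  -- i, so it takes (part p i - 1 - i) - (c - r) steps; the equation says, without subtraction, that
  -- this number is n.
  walk : ∀ n r c → i ≤ r → r ≤ d + i → InSkew p q (r , c) → part p i + r ≡ c + suc n + i → Path n r c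
  walk zero r c i≤r r≤k (q≤c , c<p) eq = record
    { steps  = (r , c) ∷ []
    ; start  = refl
    ; linked = VecLinked.[-]
    ; unique = VecAll.[] ∷ []
    ; member = λ { (x , y) → mk⇔
        (λ { (here refl) → (q≤c , c<p) , ≤-refl , λ _ → ≤-refl })
        (λ { (skew@(q≤y , y<p) , x≤r , c≤y) →
          let x≡r = ≤-antisym x≤r (subst (_≤ x) (sym r≡i) (proj₁ (row-bounds q≤y y<p)))
          in here (cong₂ _,_ x≡r (≤-antisym
               (≤-pred (≤-trans y<p (≤-reflexive (trans (cong (part p) (trans x≡r r≡i)) pᵢ≡))))
               (c≤y x≡r))) }) }
    }
    where
    -- With a single box left, suc c ≤ part p i and i ≤ r must both be equalities: the walk stands
    -- at the end of row i.
    eq′ : part p i + r ≡ suc c + i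
    eq′ = trans eq (cong (_+ i) (+-comm c 1))
    c<pᵢ : suc c ≤ part p i
    c<pᵢ = ≤-trans c<p (part-antitone p i≤r)
    r≡i : r ≡ i
    r≡i = ≤-antisym (+-cancelˡ-≤ (suc c) r i (≤-trans (+-monoˡ-≤ r c<pᵢ) (≤-reflexive eq′))) i≤r
    pᵢ≡ : part p i ≡ suc c
    pᵢ≡ = +-cancelʳ-≡ i (part p i) (suc c) (trans (cong (part p i +_) (sym r≡i)) eq′)
  walk (suc n) r c i≤r r≤k (q≤c , c<p) eq with suc c <? part p r
  ... | yes 1+c<p = extend
    (walk n r (suc c) i≤r r≤k (m≤n⇒m≤1+n q≤c , 1+c<p) (trans eq (cong (_+ i) (+-suc c (suc n)))))
    (inj₁ (refl , trans (cong (λ z → ∣ c - z ∣) (+-comm 1 c)) (∣m-m+n∣≡n c 1)))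
    (λ { (_ , _ , c<y) refl → <-irrefl refl (c<y refl) })
    (λ { {x , y} → mk⇔
      (λ { (skew , x≤r , c≤y) → case ≡-dec _≟_ _≟_ (x , y) (r , c) of λ
         { (yes eq) → inj₁ eq
         ; (no  ne) → inj₂ (skew , x≤r , λ x≡r → ≤∧≢⇒< (c≤y x≡r) λ c≡y → ne (cong₂ _,_ x≡r (sym c≡y))) } })
      (λ { (inj₁ refl) → (q≤c , c<p) , ≤-refl , λ _ → ≤-refl
         ; (inj₂ (skew , x≤r , c<y)) → skew , x≤r , <⇒≤ ∘ c<y }) })
  ... | no 1+c≮p with m≤n⇒m<n∨m≡n i≤r
  -- At the end of row i the walk is over, but the equation still asks for at least one more box.
  ...   | inj₂ refl = contradiction pᵢ≡ (<⇒≢ (≤-<-trans (≮⇒≥ 1+c≮p)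
                       (≤-trans (n<1+n (suc c)) (≤-trans (s≤s (s≤s (m≤m+n c n)))
                          (≤-reflexive (sym (trans (+-suc c (suc n)) (cong suc (+-suc c n)))))))))
    where
    pᵢ≡ : part p i ≡ c + suc (suc n)
    pᵢ≡ = +-cancelʳ-≡ i (part p i) _ eq
  -- At the end of a lower row the walk goes up. By `inner`, the first box of p / q in row s lies in
  -- this same column c, so no box of row s is skipped.
  walk (suc n) (suc s) c i≤r r≤k (q≤c , c<p) eq | no 1+c≮p | inj₁ (s≤s i≤s) = extend
    (walk n s c i≤s (<⇒≤ r≤k) (≤-reflexive qₛ≡c , <-≤-trans c<p (part-step p s)) eq′)
    (inj₂ (trans (∣-∣-comm (suc s) s) (trans (cong (λ z → ∣ s - z ∣) (+-comm 1 s)) (∣m-m+n∣≡n s 1)) , refl))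
    (λ { (_ , x≤s , _) refl → <-irrefl refl x≤s })
    (λ { {x , y} → mk⇔
      (λ { (skew@(q≤y , y<p) , x≤1+s , c≤y) → case m≤n⇒m<n∨m≡n x≤1+s of λ
         { (inj₂ refl) → inj₁ (cong (suc s ,_) (≤-antisym (≤-pred (≤-trans y<p (≮⇒≥ 1+c≮p))) (c≤y refl)))
         ; (inj₁ x<1+s) → inj₂ (skew , ≤-pred x<1+s , λ { refl → subst (_≤ y) qₛ≡c q≤y }) } })
      (λ { (inj₁ refl) → (q≤c , c<p) , ≤-refl , λ _ → ≤-refl
         ; (inj₂ (skew , x≤s , c≤y)) → skew , m≤n⇒m≤1+n x≤s , λ x≡1+s → contradiction x≡1+s (<⇒≢ (s≤s x≤s)) }) })
    where
    qₛ≡c : part q s ≡ c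
    qₛ≡c = suc-injective (trans (inner s i≤s r≤k) (≤-antisym (≮⇒≥ 1+c≮p) c<p))
    eq′ : part p i + s ≡ c + suc n + i
    eq′ = suc-injective (trans (sym (+-suc (part p i) s)) (trans eq (cong (_+ i) (+-suc c (suc n)))))

open Walk using (walk)

module _ {n p q i d} (R : Ribbon (suc n) p q i d) where
  open Ribbon R

  private
    path : Walk.Path R n (d + i) (part q (d + i))
    path = walk R n (d + i) (part q (d + i)) (m≤n+m i d) ≤-refl (≤-refl , last)
      (trans (sym (+-assoc (part p i) d i)) (cong (_+ i) size))

  open Walk.Path path

  ribbonBoxes : Vec Box (suc n)
  ribbonBoxes = steps

  ribbonBoxes-unique : Unique ribbonBoxes
  ribbonBoxes-unique = unique

  -- The walk starts at the leftmost box of the lowest row, so every box of p / q lies ahead of it.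
  ∈-ribbonBoxes : ∀ b → b ∈ ribbonBoxes ⇔ InSkew p q b
  ∈-ribbonBoxes (x , y) = mk⇔ (proj₁ ∘ to (member _)) λ skew@(q≤y , y<p) →
    from (member _) (skew , proj₂ (row-bounds q≤y y<p) , λ { refl → q≤y })

  ribbonHook : RimHook (suc n) p
  ribbonHook = record
    { boxes     = ribbonBoxes
    ; distinct  = unique
    ; inside    = VecAll.lookup⁻ λ j → proj₂ (to (∈-ribbonBoxes _) (∈-lookup j ribbonBoxes))
    ; connected = linked
    -- The two corners on the diagonal suffice: `inner` gives part p (suc r) = part q r + 1 ≤ c + 1,
    -- which leaves no room for column c + 1 in row r + 1.
    ; no2×2     = λ { r c (b₀ , _ , _ , b₁) →
        let q≤c , c<p = to (∈-ribbonBoxes _) b₀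
            q≤c′ , 1+c<p = to (∈-ribbonBoxes _) b₁
        in <-irrefl refl (≤-trans 1+c<p (≤-trans (≤-reflexive (sym (inner r (proj₁ (row-bounds q≤c c<p))
             (proj₂ (row-bounds q≤c′ 1+c<p))))) (s≤s q≤c))) }
    ; remainder = q
    ; removal   = λ { (r , c) → mk⇔
        (λ c<q → <-≤-trans c<q (⊆ r) , λ b∈ → <⇒≱ c<q (proj₁ (to (∈-ribbonBoxes _) b∈)))
        (λ { (c<p , b∉) → ≰⇒> λ q≤c → b∉ (from (∈-ribbonBoxes _) (q≤c , c<p)) }) }
    }

-- Rim hooks as inequalities between rows.

m≤n⇒∃[o]o+m≡n : ∀ {m n} → m ≤ n → ∃[ o ] o + m ≡ n
m≤n⇒∃[o]o+m≡n m≤n = _ , m∸n+n≡m m≤n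

-- By `Ribbon.size`, the last row of the ribbon is left with part p i + d - ℓ boxes. The two bounds
-- say that this is at least the length of the next row and less than the old length; ℓ is moved
-- across to avoid truncated subtraction.
record Hook (ℓ : ℕ) (p : Partition) (i d : ℕ) : Set where
  constructor hook
  field
    lower : part p (suc (d + i)) + ℓ ≤ part p i + d
    upper : part p i + d < part p (d + i) + ℓ

ribbon⇒hook : ∀ {ℓ p q i d} → Ribbon ℓ p q i d → Hook ℓ p i d
ribbon⇒hook {ℓ} {p} {q} {i} {d} R = hook
  (≤-trans (+-monoˡ-≤ ℓ (≤-trans (≤-reflexive (sym (below _ (n<1+n (d + i))))) (part-step q (d + i))))
    (≤-reflexive (sym size)))
  (≤-<-trans (≤-reflexive size) (+-monoˡ-< ℓ last))
  where open Ribbon R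

module _ {ℓ p i d} (H : Hook ℓ p i d) where
  open Hook H

  private
    k : ℕ
    k = d + i

    ℓ≤ : ℓ ≤ part p i + d
    ℓ≤ = ≤-trans (m≤n+m ℓ (part p (suc k))) lower

    end : ℕ
    end = part p i + d ∸ ℓ

    end+ℓ : end + ℓ ≡ part p i + d
    end+ℓ = m∸n+n≡m ℓ≤

    end< : end < part p k
    end< = +-cancelʳ-< ℓ end (part p k) (subst (_< part p k + ℓ) (sym end+ℓ) upper)

    ≤end : part p (suc k) ≤ end
    ≤end = +-cancelʳ-≤ ℓ (part p (suc k)) end (≤-trans lower (≤-reflexive (sym end+ℓ)))

    data Position (j : ℕ) : Set where
      above : j < i → Position j
      inner : i ≤ j → j < k → Position j
      last  : j ≡ k → Position j
      below : k < j → Position j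

    position : ∀ j → Position j
    position j with j <? i | <-cmp j k
    ... | yes j<i | _            = above j<i
    ... | no j≮i  | tri< j<k _ _ = inner (≮⇒≥ j≮i) j<k
    ... | no _    | tri≈ _ j≡k _ = last j≡k
    ... | no _    | tri> _ _ k<j = below k<j

    rows : ℕ → ℕ
    rows j with position j
    ... | above _   = part p j
    ... | inner _ _ = pred (part p (suc j))
    ... | last _    = end
    ... | below _   = part p j

    rows-above : ∀ j → j < i → rows j ≡ part p j
    rows-above j j<i with position j
    ... | above _     = refl
    ... | inner i≤j _ = contradiction i≤j (<⇒≱ j<i)
    ... | last refl   = contradiction (m≤n+m i d) (<⇒≱ j<i)
    ... | below _     = refl

    rows-inner : ∀ j → i ≤ j → j < k → rows j ≡ pred (part p (suc j))
    rows-inner j i≤j j<k with position j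
    ... | above j<i = contradiction i≤j (<⇒≱ j<i)
    ... | inner _ _ = refl
    ... | last refl = contradiction j<k (<-irrefl refl)
    ... | below k<j = contradiction j<k (<-asym k<j)

    rows-last : rows k ≡ end
    rows-last with position k
    ... | above k<i   = contradiction (m≤n+m i d) (<⇒≱ k<i)
    ... | inner _ k<k = contradiction k<k (<-irrefl refl)
    ... | last _      = refl
    ... | below k<k   = contradiction k<k (<-irrefl refl)

    rows-below : ∀ j → k < j → rows j ≡ part p j
    rows-below j k<j with position j
    ... | above _     = refl
    ... | inner _ j<k = contradiction j<k (<-asym k<j)
    ... | last refl   = contradiction k<j (<-irrefl refl)
    ... | below _     = refl

    rows≤ : ∀ j → rows j ≤ part p j
    rows≤ j with position j
    ... | above _   = ≤-refl
    ... | inner _ _ = ≤-trans pred[n]≤n (part-step p j)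
    ... | last refl = <⇒≤ end<
    ... | below _   = ≤-refl

    rows-step : ∀ j → rows (suc j) ≤ rows j
    rows-step j with position j
    ... | above _       = ≤-trans (rows≤ (suc j)) (part-step p j)
    ... | last refl     = ≤-trans (rows≤ (suc j)) ≤end
    ... | below _       = ≤-trans (rows≤ (suc j)) (part-step p j)
    ... | inner i≤j j<k = next
      where
      next : rows (suc j) ≤ pred (part p (suc j))
      next with m≤n⇒m<n∨m≡n j<k
      ... | inj₁ 1+j<k = ≤-trans (≤-reflexive (rows-inner (suc j) (m≤n⇒m≤1+n i≤j) 1+j<k))
                           (pred-mono-≤ (part-step p (suc j)))
      ... | inj₂ 1+j≡k = ≤-trans (≤-reflexive (trans (cong rows 1+j≡k) rows-last))
                           (pred-mono-≤ (subst (λ m → end < part p m) (sym 1+j≡k) end<))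

    bound : ℕ
    bound = suc k + length (parts p)

    rows-bound : rows bound ≡ 0
    rows-bound = trans (rows-below bound (m≤m+n (suc k) _)) (nth-length (parts p) (m≤n+m _ (suc k)))

  hook⇒ribbon : ∃[ q ] Ribbon ℓ p q i d
  hook⇒ribbon with fromRows rows rows-step bound rows-bound
  ... | q , q≗ , _ = q , record
    { above = λ j j<i → trans (q≗ j) (rows-above j j<i)
    ; below = λ j k<j → trans (q≗ j) (rows-below j k<j)
    -- The `pred` in `rows` does not truncate here: part p (suc j) ≥ part p k > end ≥ 0.
    ; inner = λ j i≤j j<k → trans (cong suc (trans (q≗ j) (rows-inner j i≤j j<k)))
                (suc-pred _ {{>-nonZero (≤-trans (≤-trans (s≤s z≤n) end<) (part-antitone p j<k))}})
    ; last  = subst (_< part p k) (sym (trans (q≗ k) rows-last)) end<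
    ; size  = trans (sym end+ℓ) (cong (_+ ℓ) (sym (trans (q≗ k) rows-last)))
    }

-- Every rim hook is a ribbon.

-- The order is left abstract so that one proof yields both the highest and the lowest row met by a
-- hook.
extremum : ∀ {A : Set} {_≼_ : A → A → Set} →
           (∀ x y → x ≼ y ⊎ y ≼ x) → (∀ {x y z} → x ≼ y → y ≼ z → x ≼ z) →
           ∀ {n} (xs : Vec A (suc n)) → ∃[ x ] x ∈ xs × (∀ {y} → y ∈ xs → x ≼ y)
extremum {_≼_ = _≼_} total ≼-trans = go
  where
  ≼-refl : ∀ {x} → x ≼ x
  ≼-refl {x} with total x x
  ... | inj₁ x≼x = x≼x
  ... | inj₂ x≼x = x≼x
  go : ∀ {n} (xs : Vec _ (suc n)) → ∃[ x ] x ∈ xs × (∀ {y} → y ∈ xs → x ≼ y)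
  go {zero}  (x ∷ []) = x , here refl , λ { (here refl) → ≼-refl }
  go {suc n} (x ∷ xs) with go xs
  ... | m , m∈ , m≼ with total x m
  ...   | inj₁ x≼m = x , here refl , λ { (here refl) → ≼-refl ; (there y∈) → ≼-trans x≼m (m≼ y∈) }
  ...   | inj₂ m≼x = m , there m∈ , λ { (here refl) → m≼x ; (there y∈) → m≼ y∈ }

∣m-n∣≡1∧m<n⇒n≡1+m : ∀ {m n} → ∣ m - n ∣ ≡ 1 → m < n → n ≡ suc m
∣m-n∣≡1∧m<n⇒n≡1+m {m} {n} eq m<n =
  trans (sym (m+[n∸m]≡n (<⇒≤ m<n))) (trans (cong (m +_) (trans (sym (m≤n⇒∣m-n∣≡n∸m (<⇒≤ m<n))) eq)) (+-comm m 1))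

adjacent-sym : ∀ {b b′} → Adjacent b b′ → Adjacent b′ b
adjacent-sym {_ , c} {_ , c′} (inj₁ (eq , diff)) = inj₁ (sym eq , trans (∣-∣-comm c′ c) diff)
adjacent-sym {r , _} {r′ , _} (inj₂ (diff , eq)) = inj₂ (trans (∣-∣-comm r′ r) diff , sym eq)

adjacent-cross : ∀ {j b b′} → Adjacent b b′ → proj₁ b ≤ j → j < proj₁ b′ →
                 ∃[ c ] b ≡ (j , c) × b′ ≡ (suc j , c)
adjacent-cross (inj₁ (refl , _)) r≤j j<r = contradiction r≤j (<⇒≱ j<r)
adjacent-cross {j} {r , c} {r′ , _} (inj₂ (diff , refl)) r≤j j<r′
  with refl ← ∣m-n∣≡1∧m<n⇒n≡1+m {r} {r′} diff (≤-<-trans r≤j j<r′)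
  with refl ← ≤-antisym r≤j (≤-pred j<r′) = c , refl , refl

Crosses : ℕ → ∀ {n} → Vec Box n → Set
Crosses j v = ∃[ c ] (j , c) ∈ v × (suc j , c) ∈ v

module _ {j : ℕ} where

  private
    weaken : ∀ {n b} {v : Vec Box n} → Crosses j v → Crosses j (b ∷ v)
    weaken (c , b∈ , b′∈) = c , there b∈ , there b′∈

  -- Neighbouring boxes differ by at most one row, and by one row only within a column. Hence a
  -- connected sequence with boxes on both sides of the line between rows j and j + 1 contains a
  -- vertical step across it. The order of the sequence is arbitrary, so both directions are
  -- treated.
  crosses-down : ∀ {n a b} {v : Vec Box n} → VecLinked.Linked Adjacent (a ∷ v) →
                 b ∈ v → proj₁ a ≤ j → j < proj₁ b → Crosses j (a ∷ v)
  crosses-up   : ∀ {n a b} {v : Vec Box n} → VecLinked.Linked Adjacent (a ∷ v) →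
                 b ∈ v → j < proj₁ a → proj₁ b ≤ j → Crosses j (a ∷ v)

  crosses-down {v = x ∷ _} (a~x VecLinked.∷ xs~) b∈ a≤j j<b with proj₁ x ≤? j
  ... | no x≰j with adjacent-cross a~x a≤j (≰⇒> x≰j)
  ...   | c , refl , refl = c , here refl , there (here refl)
  crosses-down (a~x VecLinked.∷ xs~) (here refl) a≤j j<b | yes x≤j = contradiction x≤j (<⇒≱ j<b)
  crosses-down (a~x VecLinked.∷ xs~) (there b∈)  a≤j j<b | yes x≤j = weaken (crosses-down xs~ b∈ x≤j j<b)

  crosses-up {v = x ∷ _} (a~x VecLinked.∷ xs~) b∈ j<a b≤j with proj₁ x ≤? j
  ... | yes x≤j with adjacent-cross (adjacent-sym a~x) x≤j j<a
  ...   | c , refl , refl = c , there (here refl) , here refl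
  crosses-up (a~x VecLinked.∷ xs~) (here refl) j<a b≤j | no x≰j = contradiction b≤j x≰j
  crosses-up (a~x VecLinked.∷ xs~) (there b∈)  j<a b≤j | no x≰j = weaken (crosses-up xs~ b∈ (≰⇒> x≰j) b≤j)

  crosses : ∀ {n a b} {v : Vec Box n} → VecLinked.Linked Adjacent v →
            a ∈ v → b ∈ v → proj₁ a ≤ j → j < proj₁ b → Crosses j v
  crosses _   (here refl) (here refl) a≤j j<b = contradiction a≤j (<⇒≱ j<b)
  crosses v~  (here refl) (there b∈)  a≤j j<b = crosses-down v~ b∈ a≤j j<b
  crosses v~  (there a∈)  (here refl) a≤j j<b = crosses-up v~ a∈ j<b a≤j
  crosses (_ VecLinked.∷ v~) (there a∈) (there b∈) a≤j j<b = weaken (crosses v~ a∈ b∈ a≤j j<b)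

module _ {n p} (h : RimHook (suc n) p) where

  private
    q : Partition
    q = remainder h

  -- `removal` describes the hook only through the boxes that survive; decidable membership turns
  -- this into a description of the hook itself.
  ∈-boxes : ∀ b → b ∈ boxes h ⇔ InSkew p q b
  ∈-boxes b@(r , c) = mk⇔
    (λ b∈ → ≮⇒≥ (λ c<q → proj₂ (to (removal h b) c<q) b∈) , VecAll.lookup (inside h) b∈)
    (λ { (q≤c , c<p) → decidable-stable (b ∈? boxes h) λ b∉ → <⇒≱ (from (removal h b) (c<p , b∉)) q≤c })

  private
    q≤p : ∀ j → part q j ≤ part p j
    q≤p j = ≮⇒≥ λ p<q → <-irrefl refl (proj₁ (to (removal h (j , part p j)) p<q))

    untouched : ∀ j → (∀ c → (j , c) ∉ boxes h) → part q j ≡ part p j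
    untouched j free = ≤-antisym (q≤p j) (≮⇒≥ λ q<p → free _ (from (∈-boxes (j , part q j)) (≤-refl , q<p)))

  -- Rows outside the extreme ones are untouched. Between them, a vertical step gives part q j <
  -- part p (suc j), and an overlap of two columns would contain a 2×2 square, so rows j and j + 1
  -- share exactly one column.
  ribbonOf : ∃[ i ] ∃[ d ] Ribbon (suc n) p q i d
  ribbonOf
    with (i , _) , top∈ , top≤ ← extremum {_≼_ = λ b b′ → proj₁ b ≤ proj₁ b′}
           (λ _ _ → ≤-total _ _) ≤-trans (boxes h)
    with (k , cₖ) , bot∈ , ≤bot ← extremum {_≼_ = λ b b′ → proj₁ b ≥ proj₁ b′}
           (λ _ _ → ≤-total _ _) (λ x≥y y≥z → ≤-trans y≥z x≥y) (boxes h)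
    with d , refl ← m≤n⇒∃[o]o+m≡n (top≤ bot∈)
    = i , d , subst (λ ℓ → Ribbon ℓ p q i d) (sym n≡m) R
    where
    R₀ : ∀ m → part p i + d ≡ part q (d + i) + m → Ribbon m p q i d
    R₀ m size = record
      { above = λ j j<i → untouched j λ c b∈ → <⇒≱ j<i (top≤ b∈)
      ; below = λ j k<j → untouched j λ c b∈ → <⇒≱ k<j (≤bot b∈)
      ; inner = inner
      ; last  = let q≤c , c<p = to (∈-boxes (d + i , cₖ)) bot∈ in ≤-<-trans q≤c c<p
      ; size  = size
      }
      where
      inner : ∀ j → i ≤ j → j < d + i → suc (part q j) ≡ part p (suc j)
      inner j i≤j j<k with crosses (connected h) top∈ bot∈ i≤j j<k
      ... | c , b∈ , b′∈ = ≤-antisym q<p′ (≮⇒≥ λ 1+q<p′ →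
        let q′≤q = part-step q j
            p′≤p = part-step p j
        in no2×2 h j (part q j)
          ( from (∈-boxes _) (≤-refl , <-≤-trans q<p′ p′≤p)
          , from (∈-boxes _) (n≤1+n _ , <-≤-trans 1+q<p′ p′≤p)
          , from (∈-boxes _) (q′≤q , q<p′)
          , from (∈-boxes _) (m≤n⇒m≤1+n q′≤q , 1+q<p′)))
        where
        q<p′ : part q j < part p (suc j)
        q<p′ = ≤-<-trans (proj₁ (to (∈-boxes (j , c)) b∈)) (proj₂ (to (∈-boxes (suc j , c)) b′∈))

    -- The size is not yet known to be suc n. A ribbon is built with the size that the row lengths
    -- dictate, and `n≡m` compares its boxes with those of `h`.
    m : ℕ
    m = part p i + d ∸ suc (part q (d + i))

    size : part p i + d ≡ part q (d + i) + suc m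
    size = trans (sym (m+[n∸m]≡n q<p+d)) (sym (+-suc (part q (d + i)) m))
      where
      q<p+d : part q (d + i) < part p i + d
      -- Only `last` is wanted here, and it does not depend on the size, so a provisional size will
      -- do.
      q<p+d = ≤-trans (Ribbon.last (R₀ _ (sym (m+[n∸m]≡n (≤-trans (q≤p (d + i))
                (≤-trans (part-antitone p (m≤n+m i d)) (m≤m+n _ d)))))))
                (≤-trans (part-antitone p (m≤n+m i d)) (m≤m+n _ d))

    R : Ribbon (suc m) p q i d
    R = R₀ (suc m) size

    n≡m : suc n ≡ suc m
    n≡m = ≤-antisym
      (unique-⊆⇒≤ (distinct h) λ {b} b∈ → from (∈-ribbonBoxes R b) (to (∈-boxes b) b∈))
      (unique-⊆⇒≤ (ribbonBoxes-unique R) λ {b} b∈ → from (∈-boxes b) (to (∈-ribbonBoxes R b) b∈))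

-- Cores and horizontality in terms of inequalities.

module _ {n : ℕ} where

  core⇒¬hook : ∀ {p i d} → IsCore (suc n) p → ¬ Hook (suc n) p i d
  core⇒¬hook core H = core (ribbonHook (proj₂ (hook⇒ribbon H)))

  ¬hook⇒core : ∀ {p} → (∀ i d → ¬ Hook (suc n) p i d) → IsCore (suc n) p
  ¬hook⇒core ¬H h with ribbonOf h
  ... | i , d , R = ¬H i d (ribbon⇒hook R)

  module _ {p} (h : RimHook (suc n) p) where

    single-row⇒horizontal : ∀ {i} → Ribbon (suc n) p (remainder h) i 0 → Horizontal h
    single-row⇒horizontal {i} R = i , VecAll.lookup⁻ λ j →
      let q≤c , c<p = to (∈-boxes h _) (∈-lookup j (boxes h))
          i≤r , r≤i = Ribbon.row-bounds R q≤c c<p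
      in ≤-antisym r≤i i≤r

    horizontal⇒single-row : ∀ {i d} → Ribbon (suc n) p (remainder h) i d → Horizontal h → d ≡ 0
    horizontal⇒single-row {i} {d} R (s , rows≡s) =
      +-cancelʳ-≡ i d 0 (trans (row≡s (m≤n+m i d) ≤-refl) (sym (row≡s ≤-refl (m≤n+m i d))))
      where
      row≡s : ∀ {j} → i ≤ j → j ≤ d + i → j ≡ s
      row≡s {j} i≤j j≤k = VecAll.lookup rows≡s
        (from (∈-boxes h (j , part (remainder h) j)) (≤-refl , Ribbon.nonempty R i≤j j≤k))

  noNonHorizontal⇒¬hook : ∀ {p i d} → NoNonHorizontal (suc n) p → ¬ Hook (suc n) p i (suc d)
  noNonHorizontal⇒¬hook nn H with hook⇒ribbon H
  ... | q , R = nn (ribbonHook R , λ horizontal → case horizontal⇒single-row (ribbonHook R) R horizontal of λ ())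

  ¬hook⇒noNonHorizontal : ∀ {p} → (∀ i d → ¬ Hook (suc n) p i (suc d)) → NoNonHorizontal (suc n) p
  ¬hook⇒noNonHorizontal ¬H (h , ¬horizontal) with ribbonOf h
  ... | i , zero  , R = ¬horizontal (single-row⇒horizontal h R)
  ... | i , suc d , R = ¬H i d (ribbon⇒hook R)

-- Horizontal removals.

record Shortened (ℓ : ℕ) (p q : Partition) (i : ℕ) : Set where
  constructor shortened
  field
    row  : part p i ≡ part q i + ℓ
    rest : ∀ j → j ≢ i → part q j ≡ part p j

module _ {n : ℕ} where

  removal⇒shortened : ∀ {p q} → HorizontalRemoval (suc n) p q → ∃[ i ] Shortened (suc n) p q i
  removal⇒shortened {p} (h , horizontal , refl) with ribbonOf h
  ... | i , d , R with refl ← horizontal⇒single-row h R horizontal =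
    i , shortened (trans (sym (+-identityʳ _)) size) rest
    where
    open Ribbon R
    rest : ∀ j → j ≢ i → part (remainder h) j ≡ part p j
    rest j j≢i with <-cmp j i
    ... | tri< j<i _ _ = above j j<i
    ... | tri≈ _ j≡i _ = contradiction j≡i j≢i
    ... | tri> _ _ i<j = below j i<j

  abstract
    shorten : ∀ {p} i → part p (suc i) + suc n ≤ part p i →
              ∃[ q ] HorizontalRemoval (suc n) p q × Shortened (suc n) p q i
    shorten {p} i wide
      with q , R ← hook⇒ribbon {suc n} {p} {i} {0} (hook
             (≤-trans wide (≤-reflexive (sym (+-identityʳ _)))) (+-monoʳ-< (part p i) (s≤s z≤n)))
      = q , p⟶q , subst (Shortened (suc n) p q) (row≡ (proj₂ short)) (proj₂ short)
      where
      h : RimHook (suc n) p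
      h = ribbonHook R
      p⟶q : HorizontalRemoval (suc n) p q
      p⟶q = h , single-row⇒horizontal h R , refl
      short : ∃[ j ] Shortened (suc n) p q j
      short = removal⇒shortened p⟶q
      -- `removal⇒shortened` returns some row j. It is row i, because row i became shorter and no
      -- row other than j changes.
      row≡ : ∀ {j} → Shortened (suc n) p q j → j ≡ i
      row≡ {j} s = decidable-stable (j ≟ i) λ j≢i →
        <-irrefl (Shortened.rest s i (j≢i ∘ sym)) (Ribbon.last R)

hook-cong : ∀ {ℓ p p′ i i′ d} → part p i ≡ part p′ i′ → part p (d + i) ≡ part p′ (d + i′) →
            part p (suc (d + i)) ≡ part p′ (suc (d + i′)) → Hook ℓ p i d → Hook ℓ p′ i′ d
hook-cong {ℓ} {d = d} eq₁ eq₂ eq₃ (hook lower upper) = hook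
  (subst₂ _≤_ (cong (_+ ℓ) eq₃) (cong (_+ d) eq₁) lower)
  (subst₂ _<_ (cong (_+ d) eq₁) (cong (_+ ℓ) eq₂) upper)

-- Partitions extending a core: no non-horizontal hooks, stability under removal.

m+[n+o]≡m+o+n : ∀ m n o → m + (n + o) ≡ m + o + n
m+[n+o]≡m+o+n = solve-∀

-- p ≈[ suc n ] (μ , r , κ) for some partition κ with at most suc r parts: the
-- multiplier in `steps` is κᵢ - κᵢ₊₁ + 1, and the one in `pivot` is κᵣ.
record Extends (n : ℕ) (μ : Partition) (r : ℕ) (p : Partition) : Set where
  field
    steps : ∀ i → i < r → ∃[ m ] suc (part p i) ≡ part p (suc i) + suc m * suc n
    pivot : ∃[ m ] part p r ≡ part μ 0 + m * suc n
    tail  : ∀ i → part p (suc i + r) ≡ part μ (suc i)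

  part₁ : part p (suc r) ≡ part μ 1
  part₁ = tail 0

module _ {n : ℕ} {μ : Partition} (core : IsCore (suc n) μ) {r : ℕ} where

  core-gap : ∀ i → part μ i < part μ (suc i) + suc n
  core-gap i = ≰⇒> λ wide → core⇒¬hook {i = i} {0} core (hook
    (≤-trans wide (≤-reflexive (sym (+-identityʳ _)))) (+-monoʳ-< (part μ i) (s≤s z≤n)))

  -- Above row r every gap is at least ℓ - 1, so a hook starting there cannot reach a second row. A
  -- hook starting below row r is a hook of μ. In row r, either the row has length μ₀ and the hook
  -- again belongs to μ, or it has length at least μ₀ + ℓ and is too long for the hook to turn down.
  extends⇒noNonHorizontal : ∀ {p} → Extends n μ r p → NoNonHorizontal (suc n) p
  extends⇒noNonHorizontal {p} E = ¬hook⇒noNonHorizontal noHook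
    where
    open Extends E
    noHook : ∀ i d → ¬ Hook (suc n) p i (suc d)
    noHook i d H@(hook lower upper) with <-cmp i r
    ... | tri< i<r _ _ with m , eq ← steps i i<r = <⇒≱ upper (begin
      part p (suc d + i) + suc n   ≤⟨ +-monoˡ-≤ (suc n) (part-antitone p (s≤s (m≤n+m i d))) ⟩
      part p (suc i) + suc n       ≤⟨ +-monoʳ-≤ (part p (suc i)) (m≤m+n (suc n) (m * suc n)) ⟩
      part p (suc i) + suc m * suc n ≡⟨ eq ⟨
      suc (part p i)               ≤⟨ s≤s (m≤m+n (part p i) d) ⟩
      suc (part p i + d)           ≡⟨ +-suc (part p i) d ⟨
      part p i + suc d             ∎)
      where open ≤-Reasoning
    ... | tri> _ _ r<i with j , refl ← m≤n⇒∃[o]o+m≡n r<i = core⇒¬hook {i = suc j} {suc d} core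
      (hook-cong
        (trans (cong (part p) (+-suc j r)) (tail j))
        (trans (cong (part p) (trans (cong (suc d +_) (+-suc j r)) (sym (+-assoc (suc d) (suc j) r)))) (tail (d + suc j)))
        (trans (cong (part p) (cong suc (trans (cong (suc d +_) (+-suc j r)) (sym (+-assoc (suc d) (suc j) r)))))
               (tail (suc d + suc j)))
        H)
    ... | tri≈ _ refl _ with pivot
    ...   | zero , eq = core⇒¬hook {i = 0} {suc d} core
      (hook-cong (trans eq (+-identityʳ _))
        (trans (tail d) (cong (part μ ∘ suc) (sym (+-identityʳ d))))
        (trans (tail (suc d)) (cong (part μ ∘ suc ∘ suc) (sym (+-identityʳ d))))
        H)
    ...   | suc m , eq = <⇒≱ upper (begin
      part p (suc d + r) + suc n  ≡⟨ cong (_+ suc n) (tail d) ⟩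
      part μ (suc d) + suc n      ≤⟨ +-mono-≤ (part-antitone μ z≤n) (m≤m+n (suc n) (m * suc n)) ⟩
      part μ 0 + suc m * suc n    ≡⟨ eq ⟨
      part p r                    ≤⟨ m≤m+n (part p r) (suc d) ⟩
      part p r + suc d            ∎)
      where open ≤-Reasoning

  -- Below row r a removal would give a horizontal hook of the core. In a row i ≤ r it lowers the
  -- multiplier of that row by one and raises the multiplier of row i - 1, if there is one.
  extends-shortened : ∀ {p q i} → Extends n μ r p → Shortened (suc n) p q i → Extends n μ r q
  extends-shortened {p} {q} {i} E (shortened row rest) with <-cmp i r
  ... | tri> _ _ r<i with j , refl ← m≤n⇒∃[o]o+m≡n r<i = contradiction (core-gap (suc j)) (≤⇒≯ (begin
      part μ (suc (suc j)) + suc n ≡⟨ cong (_+ suc n) (tail (suc j)) ⟨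
      part p (suc (suc j + r)) + suc n ≡⟨ cong (λ k → part p (suc k) + suc n) (+-suc j r) ⟨
      part p (suc (j + suc r)) + suc n ≡⟨ cong (_+ suc n) (rest _ (<⇒≢ (n<1+n _) ∘ sym)) ⟨
      part q (suc (j + suc r)) + suc n ≤⟨ +-monoˡ-≤ (suc n) (part-step q _) ⟩
      part q (j + suc r) + suc n ≡⟨ row ⟨
      part p (j + suc r) ≡⟨ cong (part p) (+-suc j r) ⟩
      part p (suc j + r) ≡⟨ tail j ⟩
      part μ (suc j) ∎))
    where
    open Extends E
    open ≤-Reasoning
  ... | tri≈ _ refl _ = record
    { steps = λ j j<r → steps′ j j<r (m≤n⇒m<n∨m≡n j<r)
    ; pivot = pivot′ pivot
    ; tail  = λ j → trans (rest _ (<⇒≢ (s≤s (m≤n+m r j)) ∘ sym)) (tail j)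
    }
    where
    open Extends E
    steps′ : ∀ j → j < r → suc j < r ⊎ suc j ≡ r → ∃[ m ] suc (part q j) ≡ part q (suc j) + suc m * suc n
    steps′ j j<r (inj₁ 1+j<r) with m , eq ← steps j j<r =
      m , trans (cong suc (rest j (<⇒≢ j<r))) (trans eq (cong (_+ _) (sym (rest (suc j) (<⇒≢ 1+j<r)))))
    steps′ j j<r (inj₂ refl) with m , eq ← steps j j<r =
      suc m , trans (cong suc (rest j (<⇒≢ j<r))) (trans eq (trans (cong (_+ _) row) (+-assoc (part q (suc j)) (suc n) _)))
    pivot′ : (∃[ m ] part p r ≡ part μ 0 + m * suc n) → ∃[ m ] part q r ≡ part μ 0 + m * suc n
    -- With multiplier 0, row r has length μ₀, and the removal would force a gap of at least ℓ
    -- between the first two rows of μ.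
    pivot′ (zero , eq) = contradiction (core-gap 0) (≤⇒≯ (begin
      part μ 1 + suc n       ≡⟨ cong (_+ suc n) part₁ ⟨
      part p (suc r) + suc n ≡⟨ cong (_+ suc n) (rest (suc r) (<⇒≢ (n<1+n r) ∘ sym)) ⟨
      part q (suc r) + suc n ≤⟨ +-monoˡ-≤ (suc n) (part-step q r) ⟩
      part q r + suc n       ≡⟨ row ⟨
      part p r               ≡⟨ trans eq (+-identityʳ _) ⟩
      part μ 0               ∎))
      where open ≤-Reasoning
    pivot′ (suc m , eq) = m , +-cancelʳ-≡ (suc n) _ _
      (trans (sym row) (trans eq (m+[n+o]≡m+o+n (part μ 0) (suc n) (m * suc n))))
  ... | tri< i<r _ _ = record
    { steps = steps′
    ; pivot = let m , eq = pivot in m , trans (rest r (<⇒≢ i<r ∘ sym)) eq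
    ; tail  = λ j → trans (rest _ (<⇒≢ (<-≤-trans i<r (≤-trans (n≤1+n r) (s≤s (m≤n+m r j)))) ∘ sym)) (tail j)
    }
    where
    open Extends E
    reduce : ∀ {x y} → suc x + suc n ≡ y + suc n → suc x ≡ y
    reduce {x} {y} = +-cancelʳ-≡ (suc n) (suc x) y
    steps′ : ∀ j → j < r → ∃[ m ] suc (part q j) ≡ part q (suc j) + suc m * suc n
    steps′ j j<r with j ≟ i | suc j ≟ i
    ... | yes refl | yes ()
    ... | no j≢i | no 1+j≢i with m , eq ← steps j j<r =
      m , trans (cong suc (rest j j≢i)) (trans eq (cong (_+ _) (sym (rest (suc j) 1+j≢i))))
    ... | no j≢i | yes refl with m , eq ← steps j j<r =
      suc m , trans (cong suc (rest j j≢i)) (trans eq (trans (cong (_+ _) row) (+-assoc (part q (suc j)) (suc n) _)))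
    ... | yes refl | no 1+j≢i with steps j j<r
    ...   | m , eq = drop m (reduce (begin
            suc (part q j) + suc n               ≡⟨ cong suc row ⟨
            suc (part p j)                       ≡⟨ eq ⟩
            part p (suc j) + suc m * suc n       ≡⟨ cong (_+ suc m * suc n) (rest (suc j) 1+j≢i) ⟨
            part q (suc j) + (suc n + m * suc n) ≡⟨ m+[n+o]≡m+o+n (part q (suc j)) (suc n) (m * suc n) ⟩
            part q (suc j) + m * suc n + suc n   ∎))
      where
      open ≡-Reasoning
      -- The lowered multiplier must stay positive: at 0, row j + 1 of q would be longer than row j.
      drop : ∀ m → suc (part q j) ≡ part q (suc j) + m * suc n →
             ∃[ m ] suc (part q j) ≡ part q (suc j) + suc m * suc n
      drop zero    eq = contradiction (≤-reflexive (trans eq (+-identityʳ _))) (<⇒≱ (s≤s (part-step q j)))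
      drop (suc m) eq = m , eq

  extends-star : ∀ {p q} → Extends n μ r p → Star (HorizontalRemoval (suc n)) p q → Extends n μ r q
  extends-star E ε = E
  extends-star E (p⟶q ◅ q⟶*r) = extends-star (extends-shortened E (proj₂ (removal⇒shortened p⟶q))) q⟶*r

-- Regularity.

count : ℕ → List ℕ → ℕ
count k xs = length (filter (_≟ k) xs)

count-accept : ∀ k xs → count k (k ∷ xs) ≡ suc (count k xs)
count-accept k xs = cong length (filter-accept (_≟ k) refl)

count-reject : ∀ {k x} xs → x ≢ k → count k (x ∷ xs) ≡ count k xs
count-reject {k} xs x≢k = cong length (filter-reject (_≟ k) {xs = xs} x≢k)

count-below : ∀ {k x xs} → Linked _≥_ (x ∷ xs) → x < k → count k (x ∷ xs) ≡ 0
count-below {xs = []}     _           x<k = count-reject [] (<⇒≢ x<k)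
count-below {xs = y ∷ ys} (x≥y ∷ ys↘) x<k =
  trans (count-reject (y ∷ ys) (<⇒≢ x<k)) (count-below ys↘ (≤-<-trans x≥y x<k))

leading-run : ∀ {k xs} → 0 < k → Linked _≥_ (k ∷ xs) →
              nth (k ∷ xs) (count k xs) ≡ k × nth xs (count k xs) < k
leading-run {k} {[]}     0<k _ = refl , 0<k
leading-run {k} {y ∷ ys} 0<k (k≥y ∷ ys↘) with y ≟ k
... | yes refl rewrite count-accept k ys = leading-run 0<k ys↘
... | no  y≢k  rewrite count-below ys↘ (≤∧≢⇒< k≥y y≢k) = refl , ≤∧≢⇒< k≥y y≢k

-- The last suc m copies of k are selected, so that the row after them is strictly smaller; that
-- strictness provides the lower bound of a hook.
run-end : ∀ {k m} xs → 0 < k → Linked _≥_ xs → suc m ≤ count k xs →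
          ∃[ i ] nth xs i ≡ k × nth xs (m + i) ≡ k × nth xs (suc (m + i)) < k
run-end {k} {m} (x ∷ xs) 0<k xs↘ m< with x ≟ k
... | no x≢k with i , eqᵢ , eqₘ , next< ← run-end xs 0<k (Linked.tail xs↘) (subst (suc m ≤_) (count-reject xs x≢k) m<)
    = suc i , eqᵢ , trans (cong (nth (x ∷ xs)) (+-suc m i)) eqₘ
            , subst (λ j → nth xs j < k) (sym (+-suc m i)) next<
... | yes refl with m≤n⇒m<n∨m≡n (≤-pred (subst (suc m ≤_) (count-accept k xs) m<))
...   | inj₁ m<count with i , eqᵢ , eqₘ , next< ← run-end xs 0<k (Linked.tail xs↘) m<count
      = suc i , eqᵢ , trans (cong (nth (x ∷ xs)) (+-suc m i)) eqₘ
              , subst (λ j → nth xs j < k) (sym (+-suc m i)) next<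
...   | inj₂ refl = 0 , refl , subst (λ c → nth (k ∷ xs) c ≡ k × nth xs c < k)
                                  (sym (+-identityʳ (count k xs))) (leading-run 0<k xs↘)

-- The last ℓ rows of a run of equal parts end in a vertical hook, with d = ℓ - 1. As ℓ ≥ 2, it is
-- not horizontal.
noNonHorizontal⇒regular : ∀ {n p} → NoNonHorizontal (2 + n) p → Regular (2 + n) p
noNonHorizontal⇒regular {n} {p} nn (k , 0<k , ℓ≤mult)
  with i , eqᵢ , eqₙ , next< ← run-end (parts p) 0<k (decreasing p) ℓ≤mult
  = noNonHorizontal⇒¬hook nn (hook
      (≤-trans (≤-reflexive (+-suc (part p (suc (suc n + i))) (suc n)))
        (+-monoˡ-≤ (suc n) (≤-trans next< (≤-reflexive (sym eqᵢ)))))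
      (≤-trans (≤-reflexive (sym (+-suc (part p i) (suc n))))
        (+-monoˡ-≤ (2 + n) (≤-reflexive (trans eqᵢ (sym eqₙ))))))

-- From triples to row congruences and back.

-- The two branches of `ν` agree at j = r, where both give part μ 0; so row r is covered together
-- with the rows above it.
ν-upper : ∀ ℓ μ {r j} → j ≤ r → ν ℓ μ r j ≡ part μ 0 + (r ∸ j) * (ℓ ∸ 1)
ν-upper ℓ μ {zero}  z≤n       = sym (+-identityʳ _)
ν-upper ℓ μ {suc r} z≤n       = refl
ν-upper ℓ μ {suc r} (s≤s j≤r) = ν-upper ℓ μ j≤r

ν-lower : ∀ ℓ μ r i → ν ℓ μ r (i + r) ≡ part μ i
ν-lower ℓ μ zero    i rewrite +-identityʳ i = refl
ν-lower ℓ μ (suc r) i rewrite +-suc i r = ν-lower ℓ μ r i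

∸-suc : ∀ {i r} → i < r → r ∸ i ≡ suc (r ∸ suc i)
∸-suc {i} {suc r} (s≤s i≤r) = +-∸-assoc 1 i≤r

ν-step : ∀ ℓ μ r i → ν ℓ μ r (suc i) ≤ ν ℓ μ r i
ν-step ℓ μ r i with i <? r
... | yes i<r = begin
  ν ℓ μ r (suc i)                     ≡⟨ ν-upper ℓ μ i<r ⟩
  part μ 0 + (r ∸ suc i) * (ℓ ∸ 1)    ≤⟨ +-monoʳ-≤ (part μ 0) (*-monoˡ-≤ (ℓ ∸ 1) (∸-monoʳ-≤ r (n≤1+n i))) ⟩
  part μ 0 + (r ∸ i) * (ℓ ∸ 1)        ≡⟨ ν-upper ℓ μ (<⇒≤ i<r) ⟨
  ν ℓ μ r i                           ∎
  where open ≤-Reasoning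
... | no i≮r with j , refl ← m≤n⇒∃[o]o+m≡n (≮⇒≥ i≮r) =
  subst₂ _≤_ (sym (ν-lower ℓ μ r (suc j))) (sym (ν-lower ℓ μ r j)) (part-step μ j)

≈-exists : ∀ ℓ μ r κ → length (parts κ) ≤ suc r → ∃[ p ] p ≈[ ℓ ] (μ , r , κ)
≈-exists ℓ μ r κ len = p , (λ i _ → p≗ i) , λ i r<i → trans (p≗ i) (rows-lower i r<i)
  where
  rows : ℕ → ℕ
  rows i = ν ℓ μ r i + ℓ * part κ i
  rows-lower : ∀ i → r < i → rows i ≡ ν ℓ μ r i
  rows-lower i r<i = trans
    (cong (ν ℓ μ r i +_) (trans (cong (ℓ *_) (nth-length (parts κ) (≤-trans len r<i))) (*-zeroʳ ℓ)))
    (+-identityʳ _)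
  bound : ℕ
  bound = suc (length (parts μ)) + r
  built = fromRows rows (λ i → +-mono-≤ (ν-step ℓ μ r i) (*-monoʳ-≤ ℓ (part-step κ i))) bound
    (trans (rows-lower bound (s≤s (m≤n+m r _)))
      (trans (ν-lower ℓ μ r (suc (length (parts μ)))) (nth-length (parts μ) (n≤1+n _))))
  p = proj₁ built
  p≗ = proj₁ (proj₂ built)

prepend : ℕ → (ℕ → ℕ) → ℕ → ℕ
prepend x f zero    = x
prepend x f (suc i) = f i

module _ {n : ℕ} where

  ≈⇒extends : ∀ {p μ r κ} → p ≈[ suc n ] (μ , r , κ) → Extends n μ r p
  ≈⇒extends {p} {μ} {r} {κ} (upper , lower) = record
    { steps = λ i i<r → part κ i ∸ part κ (suc i) , (begin
        suc (part p i) ≡⟨ cong suc (row (<⇒≤ i<r)) ⟩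
        suc (part μ 0 + (r ∸ i) * n + suc n * part κ i)
          ≡⟨ cong₂ (λ s k → suc (part μ 0 + s * n + suc n * k)) (∸-suc i<r)
               (sym (m+[n∸m]≡n (part-step κ i))) ⟩
        suc (part μ 0 + suc (r ∸ suc i) * n + suc n * (part κ (suc i) + (part κ i ∸ part κ (suc i))))
          ≡⟨ regroup (part μ 0) (r ∸ suc i) n (part κ (suc i)) (part κ i ∸ part κ (suc i)) ⟩
        part μ 0 + (r ∸ suc i) * n + suc n * part κ (suc i) + suc (part κ i ∸ part κ (suc i)) * suc n
          ≡⟨ cong (_+ suc (part κ i ∸ part κ (suc i)) * suc n) (row i<r) ⟨
        part p (suc i) + suc (part κ i ∸ part κ (suc i)) * suc n ∎)
    ; pivot = part κ r , trans (row ≤-refl) (cong₂ _+_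
        (trans (cong (λ s → part μ 0 + s * n) (n∸n≡0 r)) (+-identityʳ _)) (*-comm (suc n) (part κ r)))
    ; tail  = λ i → trans (lower _ (s≤s (m≤n+m r i))) (ν-lower (suc n) μ r (suc i))
    }
    where
    open ≡-Reasoning
    row : ∀ {i} → i ≤ r → part p i ≡ part μ 0 + (r ∸ i) * n + suc n * part κ i
    row {i} i≤r = trans (upper i i≤r) (cong (_+ suc n * part κ i) (ν-upper (suc n) μ i≤r))
    regroup : ∀ m s n k d → suc (m + suc s * n + suc n * (k + d)) ≡ m + s * n + suc n * k + suc d * suc n
    regroup = solve-∀

  -- The step multipliers are the consecutive differences of κ, and the pivot multiplier is its last
  -- entry. Summing from row r upwards recovers κ, which is continued by zeros below row r.
  telescope : ∀ (a : ℕ → ℕ) m r →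
    (∀ i → i < r → ∃[ d ] suc (a i) ≡ a (suc i) + suc d * suc n) → (∃[ d ] a r ≡ m + d * suc n) →
    Σ[ k ∈ (ℕ → ℕ) ] (∀ i → k (suc i) ≤ k i) × k (suc r) ≡ 0 × (∀ i → i ≤ r → a i ≡ m + (r ∸ i) * n + suc n * k i)
  telescope a m zero steps (d , pivot) = prepend d (λ _ → 0) , (λ { zero → z≤n ; (suc _) → z≤n }) , refl
    , λ { zero z≤n → trans pivot (cong₂ _+_ (sym (+-identityʳ m)) (*-comm d (suc n))) }
  telescope a m (suc r) steps pivot
    with k , k↘ , k₀ , rows ← telescope (a ∘ suc) m r (λ i i<r → steps (suc i) (s≤s i<r)) pivot
       | d , step ← steps 0 z<s
    = prepend (d + k 0) k , (λ { zero → m≤n+m (k 0) d ; (suc i) → k↘ i }) , k₀ , λ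
      { zero    _         → suc-injective (trans step (trans (cong (_+ suc d * suc n) (rows 0 z≤n))
                              (regroup m r n (k 0) d)))
      ; (suc i) (s≤s i≤r) → rows i i≤r }
    where
    regroup : ∀ m r n k d → m + r * n + suc n * k + suc d * suc n ≡ suc (m + suc r * n + suc n * (d + k))
    regroup = solve-∀

  extends⇒≈ : ∀ {p μ r} → Extends n μ r p →
              ∃[ κ ] length (parts κ) ≤ suc r × p ≈[ suc n ] (μ , r , κ)
  extends⇒≈ {p} {μ} {r} E
    with k , k↘ , k₀ , rows ← telescope (part p) (part μ 0) r (Extends.steps E) (Extends.pivot E)
    with κ , κ≗ , len ← fromRows k k↘ (suc r) k₀
    = κ , len
    , (λ i i≤r → trans (rows i i≤r)
         (cong₂ (λ x y → x + suc n * y) (sym (ν-upper (suc n) μ i≤r)) (sym (κ≗ i))))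
    , λ i r<i → lower i (m≤n⇒∃[o]o+m≡n r<i)
    where
    lower : ∀ i → ∃[ j ] j + suc r ≡ i → part p i ≡ ν (suc n) μ r i
    lower _ (j , refl) rewrite +-suc j r = trans (Extends.tail E j) (sym (ν-lower (suc n) μ r (suc j)))

  -- Finding the core inside an ℓ-partition.

  Hereditary : Partition → Set
  Hereditary p = ∀ q → Star (HorizontalRemoval (suc n)) p q → NoNonHorizontal (suc n) q

  hereditary-step : ∀ {p q} → Hereditary p → HorizontalRemoval (suc n) p q → Hereditary q
  hereditary-step hp p⟶q s q⟶*s = hp s (p⟶q ◅ q⟶*s)

  -- Two rows i, i + 1 with λᵢ - λᵢ₊₁ ≤ ℓ - 2 and λᵢ₊₁ - λᵢ₊₂ ≥ ℓ carry a
  -- non-horizontal hook, and a hook taken off row i + 1 widens row i.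
  no-wide-row-below : ∀ {p r} → Hereditary p → part p r < part p (suc r) + n →
                      ∀ i → part p (suc i + r) < part p (suc (suc i + r)) + suc n
  no-wide-row-below {p} {r} hp narrow i = ≰⇒> λ wide → excluded i hp narrow wide
    where
    excluded : ∀ i {p} → Hereditary p → part p r < part p (suc r) + n →
               ¬ (part p (suc (suc i + r)) + suc n ≤ part p (suc i + r))
    excluded i {p} hp narrow wide with part p (i + r) <? part p (suc i + r) + n
    ... | yes narrowᵢ = noNonHorizontal⇒¬hook (hp p ε) (hook {i = i + r} {1}
      (≤-trans wide (≤-trans (part-step p (i + r)) (m≤m+n _ 1)))
      (≤-trans (s≤s (≤-trans (≤-reflexive (+-comm _ 1)) narrowᵢ)) (≤-reflexive (sym (+-suc _ n)))))
    excluded zero    hp narrow wide | no ¬narrowᵢ = contradiction narrow ¬narrowᵢ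
    excluded (suc i) {p} hp narrow wide | no ¬narrowᵢ
      with q , p⟶q , shortened row rest ← shorten {p = p} (2 + i + r) wide
      = excluded i (hereditary-step hp p⟶q)
          (subst₂ (λ x y → x < y + n)
            (sym (rest r (<⇒≢ (≤-trans (s≤s (m≤n+m r i)) (n≤1+n _)))))
            (sym (rest (suc r) (<⇒≢ (s≤s (s≤s (m≤n+m r i))))))
            narrow)
          (begin
            part q (2 + i + r) + suc n ≡⟨ row ⟨
            part p (2 + i + r)         ≤⟨ m≤m+n _ n ⟩
            part p (2 + i + r) + n     ≤⟨ ≮⇒≥ ¬narrowᵢ ⟩
            part p (1 + i + r)         ≡⟨ rest (1 + i + r) (<⇒≢ (n<1+n _)) ⟨
            part q (1 + i + r)         ∎)
      where open ≤-Reasoning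

  -- As long as row r exceeds m by a positive multiple of ℓ, it exceeds row r + 1 by at least ℓ, so
  -- a horizontal hook can be taken off it.
  shorten-row : ∀ {p r m} → Hereditary p → part p (suc r) ≤ m → ∀ d → part p r ≡ m + d * suc n →
                ∃[ q ] Hereditary q × part q r ≡ m × (∀ j → r < j → part q j ≡ part p j)
  shorten-row {p} hp _ zero eq = p , hp , trans eq (+-identityʳ _) , λ _ _ → refl
  shorten-row {p} {r} {m} hp next≤m (suc d) eq
    with q , p⟶q , shortened row rest ← shorten {p = p} r
           (≤-trans (+-mono-≤ next≤m (m≤m+n (suc n) (d * suc n))) (≤-reflexive (sym eq)))
    with s , hs , sᵣ , s≗ ← shorten-row (hereditary-step hp p⟶q)
           (≤-trans (≤-reflexive (rest (suc r) (<⇒≢ (n<1+n r) ∘ sym))) next≤m) d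
           (+-cancelʳ-≡ (suc n) _ _ (trans (sym row) (trans eq (m+[n+o]≡m+o+n m (suc n) (d * suc n)))))
    = s , hs , sᵣ , λ j r<j → trans (s≗ j r<j) (rest j (<⇒≢ r<j ∘ sym))

  -- Once row r is cut down to m, the rows from r on are those of μ, so a non-horizontal hook of μ
  -- is one of q. Horizontal hooks need a gap of at least ℓ: the first gap is at most ℓ - 2 by
  -- `narrow`, the others are handled by `no-wide-row-below`.
  core-below : ∀ {p r m d} → Hereditary p → part p (suc r) ≤ m → m < part p (suc r) + n →
               part p r ≡ m + d * suc n →
               ∃[ μ ] IsCore (suc n) μ × part μ 0 ≡ m × (∀ i → part μ (suc i) ≡ part p (suc i + r))
  core-below {p} {r} {m} {d} hp next≤m narrow eq
    with q , hq , qᵣ , q≗ ← shorten-row hp next≤m d eq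
    = μ , ¬hook⇒core noHook , μ≗ 0 , λ i → μ≗ (suc i)
    where
    rows : ℕ → ℕ
    rows = prepend m (λ i → part p (suc i + r))
    built = fromRows rows (λ { zero → next≤m ; (suc i) → part-step p (suc i + r) })
      (suc (length (parts p))) (nth-length (parts p) (m≤n⇒m≤1+n (m≤m+n _ r)))
    μ = proj₁ built
    μ≗ = proj₁ (proj₂ built)
    q≗μ : ∀ i → part q (i + r) ≡ part μ i
    q≗μ zero    = trans qᵣ (sym (μ≗ 0))
    q≗μ (suc i) = trans (q≗ _ (s≤s (m≤n+m r i))) (sym (μ≗ (suc i)))
    narrow-q : part q r < part q (suc r) + n
    narrow-q = subst₂ (λ x y → x < y + n) (sym qᵣ) (sym (q≗ (suc r) (n<1+n r))) narrow
    gap : ∀ i → part q (i + r) < part q (suc i + r) + suc n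
    gap zero    = ≤-trans narrow-q (+-monoʳ-≤ _ (n≤1+n n))
    gap (suc i) = no-wide-row-below hq narrow-q i
    noHook : ∀ i d → ¬ Hook (suc n) μ i d
    noHook i zero    (hook lower _) = <⇒≱ (gap i) (begin
      part q (suc i + r) + suc n ≡⟨ cong (_+ suc n) (q≗μ (suc i)) ⟩
      part μ (suc i) + suc n     ≤⟨ lower ⟩
      part μ i + 0               ≡⟨ +-identityʳ _ ⟩
      part μ i                   ≡⟨ q≗μ i ⟨
      part q (i + r)             ∎)
      where open ≤-Reasoning
    noHook i (suc d) H = noNonHorizontal⇒¬hook (hq q ε) (hook-cong {p = μ} {q} {i} {i + r} {suc d}
      (sym (q≗μ i)) (sym (shifted (suc d))) (sym (shifted (suc (suc d)))) H)
      where
      shifted : ∀ d → part q (d + (i + r)) ≡ part μ (d + i)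
      shifted d = trans (cong (part q) (sym (+-assoc d i r))) (q≗μ (d + i))

-- Existence of the triple.

least : ∀ {P : ℕ → Set} → (∀ i → Dec (P i)) → ∀ {m} → P m → ∃[ r ] P r × (∀ i → i < r → ¬ P i)
least P? {m} pm with P? 0
... | yes p₀ = 0 , p₀ , λ _ ()
least P? {zero}  pm | no ¬p₀ = contradiction pm ¬p₀
least P? {suc m} pm | no ¬p₀ with r , pr , below ← least (P? ∘ suc) pm
  = suc r , pr , λ { zero _ → ¬p₀ ; (suc i) (s≤s i<r) → below i i<r }

row-gap : ∀ p i → part p i ≡ part p (suc i) + (part p i ∸ part p (suc i))
row-gap p i = sym (m+[n∸m]≡n (part-step p i))

module _ {n : ℕ} where

  private
    ℓ : ℕ
    ℓ = 2 + n

  -- Write the gap at row r as e + d ℓ with e < ℓ. The choice of r says e ≠ ℓ - 1, which is both the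
  -- narrowness that `core-below` asks for and the admissibility condition on μ, whose first part is
  -- part p (suc r) + e.
  hereditary⇒≈ : ∀ {p} → Hereditary {suc n} p → ∃[ t ] Admissible ℓ t × p ≈[ ℓ ] t
  hereditary⇒≈ {p} hp
    -- The search ends at the latest just past the last part, where the gap is 0 and ℓ ≥ 2 does not
    -- divide 1.
    with r , ℓ∤ , below ← least (λ i → ¬? (ℓ ∣? suc (part p i ∸ part p (suc i)))) {length (parts p)}
           (λ ℓ∣ → case ∣1⇒≡1 (subst (λ g → ℓ ∣ suc g)
             (trans (cong (_∸ part p (suc (length (parts p)))) (nth-length (parts p) ≤-refl)) (0∸n≡0 (part p (suc (length (parts p)))))) ℓ∣)
             of λ ())
    = attach (core-below {p = p} {r} {d = d} hp (m≤m+n _ e) (+-monoʳ-< (part p (suc r)) e<1+n) pᵣ≡)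
    where
    gap = part p r ∸ part p (suc r)
    e = gap % ℓ
    d = gap / ℓ
    pᵣ≡ : part p r ≡ part p (suc r) + e + d * ℓ
    pᵣ≡ = trans (row-gap p r) (trans (cong (part p (suc r) +_) (m≡m%n+[m/n]*n gap ℓ))
            (sym (+-assoc (part p (suc r)) e (d * ℓ))))
    e<1+n : e < suc n
    e<1+n = ≤∧≢⇒< (≤-pred (m%n<n gap ℓ)) λ e≡1+n → ℓ∤ (divides (suc d)
      (cong suc (trans (m≡m%n+[m/n]*n gap ℓ) (cong (_+ d * ℓ) e≡1+n))))
    step : ∀ i → ℓ ∣ suc (part p i ∸ part p (suc i)) → ∃[ m ] suc (part p i) ≡ part p (suc i) + suc m * ℓ
    step i (divides zero    ())
    step i (divides (suc m) eq) = m , trans (cong suc (row-gap p i))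
      (trans (sym (+-suc (part p (suc i)) _)) (cong (part p (suc i) +_) eq))
    attach : ∃[ μ ] IsCore ℓ μ × part μ 0 ≡ part p (suc r) + e × (∀ i → part μ (suc i) ≡ part p (suc i + r)) →
             ∃[ t ] Admissible ℓ t × p ≈[ ℓ ] t
    attach (μ , core , μ₀ , μ≗) with κ , len , p≈ ← extends⇒≈ {suc n} {p} {μ} {r} record
      { steps = λ i i<r → step i (decidable-stable (ℓ ∣? _) (below i i<r))
      ; pivot = d , trans pᵣ≡ (cong (_+ d * ℓ) (sym μ₀))
      ; tail  = λ i → sym (μ≗ i)
      }
      = (μ , r , κ) , (core , e≢ , len) , p≈
      where
      e≢ : part μ 0 ∸ part μ 1 ≢ suc n
      e≢ eq = <⇒≢ e<1+n (trans (sym (m+n∸m≡n (part p (suc r)) e)) (trans (sym (cong₂ _∸_ μ₀ (μ≗ 0))) eq))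

  -- Uniqueness of the triple.

  module _ {μ : Partition} (core : IsCore ℓ μ) (gap≢ : part μ 0 ∸ part μ 1 ≢ suc n) where

    private
      e : ℕ
      e = part μ 0 ∸ part μ 1

      e<ℓ : e < ℓ
      e<ℓ = +-cancelˡ-< (part μ 1) e ℓ (subst (_< part μ 1 + ℓ) (row-gap μ 0) (core-gap core {0} 0))

    -- The gap at row r is congruent to e modulo ℓ. Since e < ℓ and e ≠ ℓ - 1, we have 0 < e + 1 <
    -- ℓ, so ℓ cannot divide the gap plus one.
    extends-maximal : ∀ {p r} → Extends (suc n) μ r p → ¬ (∃[ m ] suc (part p r) ≡ part p (suc r) + suc m * ℓ)
    extends-maximal {p} {r} E (m , eq) with d , pᵣ≡ ← Extends.pivot E =
      <⇒≱ (s≤s (≤∧≢⇒< (≤-pred e<ℓ) gap≢)) (∣⇒≤ (∣m+n∣m⇒∣n (divides (suc m) (+-cancelˡ-≡ (part μ 1) _ _ (begin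
        part μ 1 + (d * ℓ + suc e)  ≡⟨ regroup (part μ 1) e (d * ℓ) ⟩
        suc (part μ 1 + e + d * ℓ)  ≡⟨ cong (λ x → suc (x + d * ℓ)) (row-gap μ 0) ⟨
        suc (part μ 0 + d * ℓ)      ≡⟨ cong suc pᵣ≡ ⟨
        suc (part p r)              ≡⟨ eq ⟩
        part p (suc r) + suc m * ℓ  ≡⟨ cong (_+ suc m * ℓ) (Extends.part₁ E) ⟩
        part μ 1 + suc m * ℓ        ∎))) (n∣m*n d)))
      where
      open ≡-Reasoning
      regroup : ∀ x y z → x + (z + suc y) ≡ suc (x + y + z)
      regroup = solve-∀

    -- Because e < ℓ, it is the remainder of the gap at row r; hence p and r determine the first
    -- part of μ.
    extends-remainder : ∀ {p r} → Extends (suc n) μ r p → part μ 0 ≡ part p (suc r) + (part p r ∸ part p (suc r)) % ℓ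
    extends-remainder {p} {r} E with d , pᵣ≡ ← Extends.pivot E = trans (row-gap μ 0) (cong₂ _+_ (sym part₁) (begin
        e                                  ≡⟨ m<n⇒m%n≡m e<ℓ ⟨
        e % ℓ                              ≡⟨ [m+kn]%n≡m%n e d ℓ ⟨
        (e + d * ℓ) % ℓ                    ≡⟨ cong (_% ℓ) (m+n∸m≡n (part μ 1) (e + d * ℓ)) ⟨
        (part μ 1 + (e + d * ℓ) ∸ part μ 1) % ℓ
          ≡⟨ cong (λ x → (x ∸ part μ 1) % ℓ) (+-assoc (part μ 1) e (d * ℓ)) ⟨
        (part μ 1 + e + d * ℓ ∸ part μ 1) % ℓ
          ≡⟨ cong (λ x → (x + d * ℓ ∸ part μ 1) % ℓ) (row-gap μ 0) ⟨
        (part μ 0 + d * ℓ ∸ part μ 1) % ℓ  ≡⟨ cong₂ (λ x y → (x ∸ y) % ℓ) pᵣ≡ part₁ ⟨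
        (part p r ∸ part p (suc r)) % ℓ    ∎))
      where
      open Extends E
      open ≡-Reasoning

  ≈-unique : ∀ {p t t′} → Admissible ℓ t → p ≈[ ℓ ] t → Admissible ℓ t′ → p ≈[ ℓ ] t′ → t ≡ t′
  ≈-unique {p} {μ , r , κ} {μ′ , r′ , κ′} (core , gap≢ , len) p≈t@(upper , _) (core′ , gap≢′ , len′) p≈t′@(upper′ , _)
    with E ← ≈⇒extends {p = p} {μ} {r} {κ} p≈t | E′ ← ≈⇒extends {p = p} {μ′} {r′} {κ′} p≈t′
    with <-cmp r r′
  -- The triple with the larger index has a step at the smaller one, which the other triple forbids.
  ... | tri< r<r′ _ _ = contradiction (Extends.steps E′ r r<r′) (extends-maximal core gap≢ E)
  ... | tri> _ _ r′<r = contradiction (Extends.steps E r′ r′<r) (extends-maximal core′ gap≢′ E′)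
  ... | tri≈ _ refl _
    with refl ← part-injective {μ} {μ′} (λ
           { zero    → trans (extends-remainder core gap≢ E) (sym (extends-remainder core′ gap≢′ E′))
           ; (suc i) → trans (sym (Extends.tail E i)) (Extends.tail E′ i) })
    = cong (λ κ → μ , r , κ) (part-injective λ i → case i ≤? r of λ
        { (yes i≤r) → *-cancelˡ-≡ _ _ ℓ (+-cancelˡ-≡ (ν ℓ μ r i) _ _ (trans (sym (upper i i≤r)) (upper′ i i≤r)))
        ; (no i≰r)  → trans (nth-length (parts κ) (≤-trans len (≰⇒> i≰r)))
                        (sym (nth-length (parts κ′) (≤-trans len′ (≰⇒> i≰r)))) })

theorem2p3p2p2 : (ℓ : ℕ) → 2 ≤ ℓ →
    ((μ : Partition) (r : ℕ) (κ : Partition) → Admissible ℓ (μ , r , κ) →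
    ∃ (λ p → p ≈[ ℓ ] (μ , r , κ))
    × ((p : Partition) → p ≈[ ℓ ] (μ , r , κ) → IsℓPartition ℓ p))
    × ((p : Partition) → IsℓPartition ℓ p →
    ∃! _≡_ (λ t → Admissible ℓ t × p ≈[ ℓ ] t))
theorem2p3p2p2 ℓ@(suc (suc n)) (s≤s (s≤s z≤n)) =
  (λ μ r κ (core , _ , len) → ≈-exists ℓ μ r κ len , λ p p≈t →
    let E = ≈⇒extends {p = p} {μ} {r} {κ} p≈t
        nn = extends⇒noNonHorizontal core E
    in record
      { regular         = noNonHorizontal⇒regular nn
      ; noNonHorizontal = nn
      ; hereditary      = λ q p⟶*q → extends⇒noNonHorizontal core (extends-star core E p⟶*q)
      }) ,
  λ p isℓ → let t , admissible , p≈t = hereditary⇒≈ (IsℓPartition.hereditary isℓ)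
            in t , (admissible , p≈t) , λ (admissible′ , p≈t′) → ≈-unique {p = p} admissible p≈t admissible′ p≈t′
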